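{- Let $R$ be a commutative ring. Let $\ell\in\mathbb{N}$, $p\in\mathbb{Z}$ and $q\in\mathbb{Z}$. Let $g_{k,\,j}$ be an element of $R$ for all $k,j\in\mathbb{Z}$. Assume that $$g_{k,\,j}=0\quad\text{for all }k<0\text{ and }j\in\mathbb{Z}.$$ For any $m\in\mathbb{N}$ and any $\mu\in\mathbb{Z}^m$ and $\beta\in\mathbb{Z}^m$, define $$s_{\mu,\,\beta}:=\det\left(\left(g_{\mu_i+j-i,\ \beta_i+j-i}\right)_{i,j\in[m]}\right)\in R.$$ Let $\mu\in\mathbb{Z}^{\ell+1}$ be an $(\ell+1)$-tuple satisfying $\mu_{\ell+1}=0$. Let $\overline{\mu}$ be the $\ell$-tuple $(\mu_1,\mu_2,\ldots,\mu_\ell)\in\mathbb{Z}^\ell$. Let $\beta\in\mathbb{Z}^\ell$ be an $\ell$-tuple, and let $\beta'\in\mathbb{Z}^{\ell+1}$ be the $(\ell+1)$-tuple $(\beta_1,\beta_2,\ldots,\beta_\ell,\,q-p)$. Then $$g_{p,\,q}\cdot s_{\overline{\mu},\,\beta}=\sum_{\substack{\delta\in\mathbb{N}^{\ell+1};\\ |\delta|=p}}s_{\mu+\delta,\ \beta'+\delta}.$$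
   Context: $\mathbb{N}=\{0,1,2,\ldots\}$ and $[m]=\{1,2,\ldots,m\}$. For an $m$-tuple $\alpha$, $\alpha_i$ denotes its $i$-th entry, and for a tuple $\alpha\in\mathbb{Z}^m$ we set $|\alpha|:=\alpha_1+\cdots+\alpha_m$. Addition of tuples is entrywise. $(a_{i,j})_{i,j\in[m]}$ denotes the $m\times m$-matrix with $(i,j)$-th entry $a_{i,j}$. -}

module Defs where

open import Algebra.Bundles using (CommutativeRing; Semiring)
open import Data.Fin.Base as Fin using (Fin; zero; suc; toℕ; punchIn)
open import Data.Fin.Permutation as Perm using (Permutation′; _⟨$⟩ʳ_; insert; remove)
open import Data.Fin.Properties as Fin using (punchIn-injective)
open import Data.Integer.Base as ℤ using (ℤ; +_)
open import Data.Integer.Properties as ℤ using (_≟_)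
open import Data.List.Base as List
  using (List; [_]; allFin; cartesianProduct; cartesianProductWith; filter; length; upTo)
open import Data.List.Membership.Propositional using (_∈_)
open import Data.List.Membership.Propositional.Properties
  using (∈-allFin; ∈-cartesianProductWith⁺; ∈-filter⁺; ∈-filter⁻; ∈-upTo⁺)
import Data.List.Membership.Setoid as SetoidMembership
import Data.List.Membership.Setoid.Properties as SetoidMembership
open import Data.List.Relation.Unary.All using ([])
open import Data.List.Relation.Unary.AllPairs using ([]; _∷_)
open import Data.List.Relation.Unary.Any using (here)
open import Data.List.Relation.Unary.Unique.Propositional using (Unique)
import Data.List.Relation.Unary.Unique.Propositional.Properties as Unique
import Data.List.Relation.Unary.Unique.Setoid as SetoidUnique
import Data.List.Relation.Unary.Unique.Setoid.Properties as SetoidUnique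
open import Data.Nat.Base as ℕ using (ℕ; zero; suc; s≤s)
import Data.Nat.Properties as ℕ
open import Data.Product.Base using (_×_; _,_; proj₂)
open import Data.Vec.Base as Vec using (Vec; []; _∷_; lookup)
open import Data.Vec.Properties using (∷-injective)
open import Function.Bundles using (_⇔_; mk⇔)
open import Level using (0ℓ)
open import Relation.Binary.Bundles using (Setoid)
open import Relation.Binary.PropositionalEquality
  using (_≡_; refl; sym; trans; cong; cong₂; setoid)
open import Relation.Nullary.Decidable using (_×-dec_)

-- All permutations of Fin n, one for each choice of the image j of zero and of
-- a permutation of the rest.
permutations : ∀ n → List (Permutation′ n)
permutations zero    = [ Perm.id ]
permutations (suc n) = cartesianProductWith (insert zero) (allFin (suc n)) (permutations n)

inversions : ∀ {n} → Permutation′ n → ℕ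
inversions {n} π = length (filter inversion? (cartesianProduct (allFin n) (allFin n)))
  where inversion? = λ ((i , j) : Fin n × Fin n) → (i Fin.<? j) ×-dec ((π ⟨$⟩ʳ j) Fin.<? (π ⟨$⟩ʳ i))

boundedTuples : ∀ m → ℕ → List (Vec ℕ m)
boundedTuples zero    b = [ [] ]
boundedTuples (suc m) b = cartesianProductWith _∷_ (upTo (suc b)) (boundedTuples m b)

-- All δ ∈ ℕᵐ with |δ| = p; the bound ∣ p ∣ on the entries excludes none of them,
-- and the list is empty when p < 0.
tuplesOfSize : ∀ m → ℤ → List (Vec ℕ m)
tuplesOfSize m p = filter (λ δ → + Vec.sum δ ℤ.≟ p) (boundedTuples m ℤ.∣ p ∣)

_⊕_ : ∀ {m} → Vec ℤ m → Vec ℕ m → Vec ℤ m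
μ ⊕ δ = Vec.zipWith ℤ._+_ μ (Vec.map +_ δ)

module _ {c r} (R : CommutativeRing c r) where
  open CommutativeRing R
  open import Algebra.Definitions.RawSemiring (Semiring.rawSemiring semiring)
    using (product; _^_)

  ∑ : ∀ {a} {A : Set a} → List A → (A → Carrier) → Carrier
  ∑ xs f = List.foldr _+_ 0# (List.map f xs)

  det : ∀ {m} → (Fin m → Fin m → Carrier) → Carrier
  det {m} A = ∑ (permutations m) λ π → (- 1#) ^ inversions π * product (λ i → A i (π ⟨$⟩ʳ i))

  -- Indices start at 0 here rather than at 1, which does not affect j - i.
  s : (ℤ → ℤ → Carrier) → ∀ {m} → Vec ℤ m → Vec ℤ m → Carrier
  s g μ β = det λ i j →
    g (lookup μ i ℤ.+ + toℕ j ℤ.- + toℕ i) (lookup β i ℤ.+ + toℕ j ℤ.- + toℕ i)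

-- The two enumerations list every element exactly once.

permutationSetoid : ℕ → Setoid 0ℓ 0ℓ
permutationSetoid n = record
  { Carrier       = Permutation′ n
  ; _≈_           = Perm._≈_
  ; isEquivalence = record
    { refl  = λ i → refl
    ; sym   = λ e i → sym (e i)
    ; trans = λ e f i → trans (e i) (f i)
    }
  }

insert-cong : ∀ {n} {i j : Fin (suc n)} {π ρ : Permutation′ n} →
              i ≡ j → π Perm.≈ ρ → insert zero i π Perm.≈ insert zero j ρ
insert-cong i≡j π≈ρ zero    = i≡j
insert-cong i≡j π≈ρ (suc k) = cong₂ punchIn i≡j (π≈ρ k)

insert-injective : ∀ {n} {i j : Fin (suc n)} {π ρ : Permutation′ n} →
                   insert zero i π Perm.≈ insert zero j ρ → i ≡ j × π Perm.≈ ρ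
insert-injective {i = i} {π = π} {ρ = ρ} e with refl ← e zero =
  refl , λ k → punchIn-injective i (π ⟨$⟩ʳ k) (ρ ⟨$⟩ʳ k) (e (suc k))

permutations-complete : ∀ {n} (π : Permutation′ n) →
                        SetoidMembership._∈_ (permutationSetoid n) π (permutations n)
permutations-complete {zero}  π = here λ ()
permutations-complete {suc n} π = SetoidMembership.∈-resp-≈ (permutationSetoid (suc n))
  {x = insert zero (π ⟨$⟩ʳ zero) (remove zero π)} {y = π}
  (Perm.insert-remove zero π)
  (SetoidMembership.∈-cartesianProductWith⁺
    (setoid (Fin (suc n))) (permutationSetoid n) (permutationSetoid (suc n))
    (λ {i} {j} {π} {ρ} → insert-cong {π = π} {ρ})
    (∈-allFin (π ⟨$⟩ʳ zero)) (permutations-complete (remove zero π)))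

permutations-unique : ∀ n → SetoidUnique.Unique (permutationSetoid n) (permutations n)
permutations-unique zero    = [] ∷ []
permutations-unique (suc n) = SetoidUnique.cartesianProductWith⁺
  (setoid (Fin (suc n))) (permutationSetoid n) (permutationSetoid (suc n)) (insert zero)
  (λ {i} {j} {π} {ρ} → insert-injective {π = π} {ρ})
  (Unique.allFin⁺ (suc n)) (permutations-unique n)

∈-boundedTuples : ∀ {m b} (δ : Vec ℕ m) → Vec.sum δ ℕ.≤ b → δ ∈ boundedTuples m b
∈-boundedTuples []      _ = here refl
∈-boundedTuples (d ∷ δ) h = ∈-cartesianProductWith⁺ _∷_
  (∈-upTo⁺ (s≤s (ℕ.m+n≤o⇒m≤o d h))) (∈-boundedTuples δ (ℕ.m+n≤o⇒n≤o d h))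

boundedTuples-unique : ∀ m b → Unique (boundedTuples m b)
boundedTuples-unique zero    b = [] ∷ []
boundedTuples-unique (suc m) b = Unique.cartesianProductWith⁺ _∷_ ∷-injective
  (Unique.upTo⁺ (suc b)) (boundedTuples-unique m b)

∈-tuplesOfSize : ∀ {m p} {δ : Vec ℕ m} → δ ∈ tuplesOfSize m p ⇔ + Vec.sum δ ≡ p
∈-tuplesOfSize {m} {p} {δ} = mk⇔
  (λ δ∈ → proj₂ (∈-filter⁻ (λ δ → + Vec.sum δ ℤ.≟ p) {xs = boundedTuples m ℤ.∣ p ∣} δ∈))
  (λ e → ∈-filter⁺ (λ δ → + Vec.sum δ ℤ.≟ p)
    (∈-boundedTuples δ (ℕ.≤-reflexive (cong ℤ.∣_∣ e))) e)

tuplesOfSize-unique : ∀ m p → Unique (tuplesOfSize m p)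
tuplesOfSize-unique m p = Unique.filter⁺ (λ δ → + Vec.sum δ ℤ.≟ p)
  (boundedTuples-unique m ℤ.∣ p ∣)

module Submission where

-- Number rows and columns from 0 and put hᵢ(k) = g(μᵢ + k − i, β′ᵢ + k − i).  The sum over all δ
-- with |δ| = p is the coefficient of tᵖ in the determinant over R[[t]] of the matrix with entries
-- ∑ᵈ hᵢ(j + d) tᵈ.  Entry (i, j) of it is hᵢ(j) plus t times entry (i, j + 1), so subtracting t
-- times the next column turns every column but the last into the constants hᵢ(j).  In the last row
-- these constants vanish, because g(k, j) = 0 for k < 0, and expanding along that row leaves
-- (∑ᵈ hℓ(ℓ + d) tᵈ) · s(μ̄, β), whose tᵖ-coefficient is g(p, q) · s(μ̄, β).

open import Defs
open import Algebra.Bundles using (CommutativeMonoid; CommutativeRing; Semiring)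
open import Data.Bool.Base using (Bool; true; false; if_then_else_; _∧_)
open import Data.Empty using (⊥-elim)
open import Data.Fin.Base as Fin
  using (Fin; zero; suc; toℕ; fromℕ; fromℕ<; inject₁; punchIn; punchOut)
open import Data.Fin.Permutation using (Permutation′; _⟨$⟩ʳ_; insert)
import Data.Fin.Properties as Fin
open import Data.Integer.Base as ℤ using (ℤ; 0ℤ; +_; -[1+_])
import Data.Integer.Properties as ℤ
open import Data.List.Base as List using (List; []; _∷_; _++_)
open import Data.Nat.Base as ℕ using (ℕ; zero; suc; _≤_; _<_; z≤n; s≤s; _<ᵇ_; _≡ᵇ_)
import Data.Nat.Properties as ℕ
open import Data.Product.Base using (_×_; _,_; ∃-syntax)
open import Data.Sum.Base using (_⊎_; inj₁; inj₂)
open import Data.Vec.Base as Vec using (Vec; []; _∷_; lookup; init; last; _∷ʳ_)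
import Data.Vec.Properties as Vec
open import Function.Base using (_∘_)
open import Relation.Binary.PropositionalEquality as ≡ using (_≡_; _≢_)
open import Relation.Nullary.Decidable using (does; yes; no; dec-true; dec-false)
open import Relation.Unary using (Pred; Decidable)

-- Sums over lists in a commutative monoid.

module ListSum {c ℓ} (M : CommutativeMonoid c ℓ) where
  open CommutativeMonoid M
    renaming (_∙_ to _+_; ε to 0#; ∙-cong to +-cong; ∙-congˡ to +-congˡ; identityˡ to +-identityˡ;
              assoc to +-assoc)
  open import Algebra.Properties.CommutativeMonoid.Sum M
  open import Algebra.Properties.CommutativeSemigroup
    (CommutativeMonoid.commutativeSemigroup M) using (interchange)

  ∑ᴸ : ∀ {a} {A : Set a} → List A → (A → Carrier) → Carrier
  ∑ᴸ xs f = List.foldr _+_ 0# (List.map f xs)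

  module _ {a} {A : Set a} where

    ∑ᴸ-cong : ∀ (xs : List A) {f g} → (∀ x → f x ≈ g x) → ∑ᴸ xs f ≈ ∑ᴸ xs g
    ∑ᴸ-cong []       f≈g = refl
    ∑ᴸ-cong (x ∷ xs) f≈g = +-cong (f≈g x) (∑ᴸ-cong xs f≈g)

    ∑ᴸ-zero : ∀ (xs : List A) → ∑ᴸ xs (λ _ → 0#) ≈ 0#
    ∑ᴸ-zero []       = refl
    ∑ᴸ-zero (x ∷ xs) = trans (+-identityˡ _) (∑ᴸ-zero xs)

    ∑ᴸ-distrib-+ : ∀ (xs : List A) f g → ∑ᴸ xs (λ x → f x + g x) ≈ ∑ᴸ xs f + ∑ᴸ xs g
    ∑ᴸ-distrib-+ []       f g = sym (+-identityˡ _)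
    ∑ᴸ-distrib-+ (x ∷ xs) f g = trans (+-congˡ (∑ᴸ-distrib-+ xs f g)) (interchange _ _ _ _)

    ∑ᴸ-++ : ∀ (xs ys : List A) f → ∑ᴸ (xs ++ ys) f ≈ ∑ᴸ xs f + ∑ᴸ ys f
    ∑ᴸ-++ []       ys f = sym (+-identityˡ _)
    ∑ᴸ-++ (x ∷ xs) ys f = trans (+-congˡ (∑ᴸ-++ xs ys f)) (sym (+-assoc _ _ _))

    ∑ᴸ-tabulate : ∀ {n} (h : Fin n → A) f → ∑ᴸ (List.tabulate h) f ≈ sum (f ∘ h)
    ∑ᴸ-tabulate {zero}  h f = refl
    ∑ᴸ-tabulate {suc n} h f = +-congˡ (∑ᴸ-tabulate (h ∘ suc) f)

    -- Trades the filter for a guard in the summand, so that the index list becomes a full product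
    -- and its sum can be iterated.
    ∑ᴸ-filter : ∀ {p} {P : Pred A p} (P? : Decidable P) xs f →
                ∑ᴸ (List.filter P? xs) f ≈ ∑ᴸ xs (λ x → if does (P? x) then f x else 0#)
    ∑ᴸ-filter P? []       f = refl
    ∑ᴸ-filter P? (x ∷ xs) f with does (P? x)
    ... | true  = +-congˡ (∑ᴸ-filter P? xs f)
    ... | false = trans (∑ᴸ-filter P? xs f) (sym (+-identityˡ _))

    ∑ᴸ-sum-comm : ∀ (xs : List A) {n} (f : A → Fin n → Carrier) →
                  ∑ᴸ xs (λ x → sum (f x)) ≈ sum (λ j → ∑ᴸ xs (λ x → f x j))
    ∑ᴸ-sum-comm []       {n} f = sym (sum-replicate-zero n)
    ∑ᴸ-sum-comm (x ∷ xs) f = trans (+-congˡ (∑ᴸ-sum-comm xs f)) (sym (∑-distrib-+ (f x) _))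

  ∑ᴸ-map : ∀ {a b} {A : Set a} {B : Set b} (h : A → B) xs f → ∑ᴸ (List.map h xs) f ≈ ∑ᴸ xs (f ∘ h)
  ∑ᴸ-map h []       f = refl
  ∑ᴸ-map h (x ∷ xs) f = +-congˡ (∑ᴸ-map h xs f)

  ∑ᴸ-cartesianProductWith :
    ∀ {a b d} {A : Set a} {B : Set b} {D : Set d} (h : A → B → D) xs ys f →
    ∑ᴸ (List.cartesianProductWith h xs ys) f ≈ ∑ᴸ xs (λ x → ∑ᴸ ys (λ y → f (h x y)))
  ∑ᴸ-cartesianProductWith h []       ys f = refl
  ∑ᴸ-cartesianProductWith h (x ∷ xs) ys f = trans (∑ᴸ-++ (List.map (h x) ys) _ f)
    (+-cong (∑ᴸ-map (h x) ys f) (∑ᴸ-cartesianProductWith h xs ys f))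

-- Inversions of a permutation built by `insert zero`.

module _ where
  open ≡ using (refl; cong; cong₂; trans; sym)
  open import Algebra.Properties.CommutativeMonoid.Sum ℕ.+-0-commutativeMonoid
  open ListSum ℕ.+-0-commutativeMonoid

  indicator : Bool → ℕ
  indicator b = if b then 1 else 0

  length≡∑ᴸ : ∀ {a} {A : Set a} (xs : List A) → List.length xs ≡ ∑ᴸ xs (λ _ → 1)
  length≡∑ᴸ []       = refl
  length≡∑ᴸ (x ∷ xs) = cong suc (length≡∑ᴸ xs)

  -- In this form the pairs that involve position `zero` split off by computation.
  inversions≡sum : ∀ {n} (π : Permutation′ n) → inversions π ≡
    sum λ a → sum λ b →
      indicator ((toℕ a <ᵇ toℕ b) ∧ (toℕ (π ⟨$⟩ʳ b) <ᵇ toℕ (π ⟨$⟩ʳ a)))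
  inversions≡sum {n} π =
    trans (length≡∑ᴸ (List.filter _ (List.cartesianProduct (List.allFin n) (List.allFin n))))
    (trans (∑ᴸ-filter _ (List.cartesianProduct (List.allFin n) (List.allFin n)) _)
    (trans (∑ᴸ-cartesianProductWith _,_ (List.allFin n) (List.allFin n) _)
    (trans (∑ᴸ-cong (List.allFin n) (λ a → ∑ᴸ-tabulate {n = n} (λ b → b) (inverted a)))
    (∑ᴸ-tabulate {n = n} (λ a → a) (λ a → sum (inverted a))))))
    where
    inverted : Fin n → Fin n → ℕ
    inverted a b = indicator ((toℕ a <ᵇ toℕ b) ∧ (toℕ (π ⟨$⟩ʳ b) <ᵇ toℕ (π ⟨$⟩ʳ a)))

  punchIn-<ᵇ : ∀ {n} (j : Fin (suc n)) (x y : Fin n) →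
               (toℕ (punchIn j x) <ᵇ toℕ (punchIn j y)) ≡ (toℕ x <ᵇ toℕ y)
  punchIn-<ᵇ zero    x       y       = refl
  punchIn-<ᵇ (suc j) zero    zero    = refl
  punchIn-<ᵇ (suc j) zero    (suc y) = refl
  punchIn-<ᵇ (suc j) (suc x) zero    = refl
  punchIn-<ᵇ (suc j) (suc x) (suc y) = punchIn-<ᵇ j x y

  -- `punchIn j` is increasing and skips only `j`, so exactly the arguments below `j` stay below it.
  count-punchIn-< : ∀ {n} (j : Fin (suc n)) →
                    sum (λ c → indicator (toℕ (punchIn j c) <ᵇ toℕ j)) ≡ toℕ j
  count-punchIn-< {n}     zero    = sum-replicate-zero n
  count-punchIn-< {suc n} (suc j) = cong suc (count-punchIn-< j)

  -- A pair that starts at position `zero` is inverted when the later image lies below `j`, which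
  -- happens `toℕ j` times. All other images pass through `punchIn j`, which preserves order, so
  -- they keep the inversions of `π`.
  inversions-insert : ∀ {n} (j : Fin (suc n)) (π : Permutation′ n) →
                      inversions (insert zero j π) ≡ toℕ j ℕ.+ inversions π
  inversions-insert j π = trans (inversions≡sum (insert zero j π)) (cong₂ ℕ._+_
    -- Reindexing by `π` removes it from the count of images below `j`.
    (trans (sym (sum-permute (λ c → indicator (toℕ (punchIn j c) <ᵇ toℕ j)) π)) (count-punchIn-< j))
    (trans (sum-cong-≗ λ a → sum-cong-≗ λ b →
              cong (λ t → indicator ((toℕ a <ᵇ toℕ b) ∧ t)) (punchIn-<ᵇ j (π ⟨$⟩ʳ b) (π ⟨$⟩ʳ a)))
           (sym (inversions≡sum π))))

-- Positions of columns after one column is deleted.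

-- For a minor of a matrix with two equal adjacent columns: if the deleted column `j` is neither of
-- them, they are still adjacent in the minor, at position `l`.
punchIn-adjacent : ∀ {n} (j : Fin (suc (suc n))) (k : Fin (suc n)) → j ≢ inject₁ k → j ≢ suc k →
                   ∃[ l ] punchIn j (inject₁ l) ≡ inject₁ k × punchIn j (suc l) ≡ suc k
punchIn-adjacent         zero          zero    j≢k _    = ⊥-elim (j≢k ≡.refl)
punchIn-adjacent         zero          (suc k) _   _    = k , ≡.refl , ≡.refl
punchIn-adjacent         (suc zero)    zero    _   j≢k₊ = ⊥-elim (j≢k₊ ≡.refl)
punchIn-adjacent {suc n} (suc (suc j)) zero    _   _    = zero , ≡.refl , ≡.refl
punchIn-adjacent {suc n} (suc j)       (suc k) j≢k j≢k₊
  with l , e , e₊ ← punchIn-adjacent j k (j≢k ∘ ≡.cong suc) (j≢k₊ ∘ ≡.cong suc)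
  = suc l , ≡.cong suc e , ≡.cong suc e₊

-- Compares the minors that lack one of two adjacent columns. They differ in a single position,
-- where each contains the column missing from the other.
punchIn-inject₁-suc : ∀ {n} (k m : Fin n) → punchIn (inject₁ k) m ≡ punchIn (suc k) m
                      ⊎ punchIn (inject₁ k) m ≡ suc k × punchIn (suc k) m ≡ inject₁ k
punchIn-inject₁-suc zero    zero    = inj₂ (≡.refl , ≡.refl)
punchIn-inject₁-suc zero    (suc m) = inj₁ ≡.refl
punchIn-inject₁-suc (suc k) zero    = inj₁ ≡.refl
punchIn-inject₁-suc (suc k) (suc m) with punchIn-inject₁-suc k m
... | inj₁ e         = inj₁ (≡.cong suc e)
... | inj₂ (e , e₊) = inj₂ (≡.cong suc e , ≡.cong suc e₊)

-- Together with `punchIn-inject₁-fromℕ`, this says that deleting a column other than the last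
-- leaves the last column last. This is what the induction in `det-last-row` needs.
punchIn-inject₁ : ∀ {n} (j : Fin (suc n)) (k : Fin n) →
                  punchIn (inject₁ j) (inject₁ k) ≡ inject₁ (punchIn j k)
punchIn-inject₁ zero    k       = ≡.refl
punchIn-inject₁ (suc j) zero    = ≡.refl
punchIn-inject₁ (suc j) (suc k) = ≡.cong suc (punchIn-inject₁ j k)

punchIn-fromℕ : ∀ {n} (k : Fin n) → punchIn (fromℕ n) k ≡ inject₁ k
punchIn-fromℕ zero    = ≡.refl
punchIn-fromℕ (suc k) = ≡.cong suc (punchIn-fromℕ k)

punchIn-inject₁-fromℕ : ∀ {n} (j : Fin (suc n)) →
                        punchIn (inject₁ j) (fromℕ n) ≡ fromℕ (suc n)
punchIn-inject₁-fromℕ zero = ≡.refl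
punchIn-inject₁-fromℕ {suc n} (suc j) = ≡.cong suc (punchIn-inject₁-fromℕ j)

-- Determinants over a commutative ring: Laplace expansion and column operations.

module Determinant {c r} (R : CommutativeRing c r) where
  open CommutativeRing R hiding (zero)
  open import Algebra.Properties.Ring ring using (-1*x≈-x)
  open import Algebra.Properties.CommutativeSemigroup *-commutativeSemigroup
    using (interchange; x∙yz≈y∙xz)
  open import Algebra.Definitions.RawSemiring (Semiring.rawSemiring semiring) using (product)
  open import Algebra.Properties.Semiring.Exp semiring using (_^_; ^-homo-*; ^-congʳ)
  open import Algebra.Properties.Semiring.Sum semiring
  open import Relation.Binary.Reasoning.Setoid setoid
  open ListSum +-commutativeMonoid public

  Matrix : ℕ → Set c
  Matrix n = Fin n → Fin n → Carrier

  ∑ᴸ-distribˡ : ∀ {a} {A : Set a} x (ys : List A) f → x * ∑ᴸ ys f ≈ ∑ᴸ ys (λ y → x * f y)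
  ∑ᴸ-distribˡ x []       f = zeroʳ x
  ∑ᴸ-distribˡ x (y ∷ ys) f = trans (distribˡ x _ _) (+-congˡ (∑ᴸ-distribˡ x ys f))

  minor : ∀ {n} → Matrix (suc n) → Fin (suc n) → Matrix n
  minor A j i k = A (suc i) (punchIn j k)

  sign : ∀ {n} → Fin n → Carrier
  sign j = (- 1#) ^ toℕ j

  laplaceTerm : ∀ {n} → Matrix (suc n) → Fin (suc n) → Carrier
  laplaceTerm A j = sign j * (A zero j * det R (minor A j))

  -- Laplace expansion along row `zero`. The list `permutations (suc n)` is already grouped by the
  -- image `j` of `zero`, and the `toℕ j` extra inversions of `insert zero j π` supply the sign.
  det-expand : ∀ {n} (A : Matrix (suc n)) → det R A ≈ sum (laplaceTerm A)
  det-expand {n} A = begin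
    det R A
      ≈⟨ ∑ᴸ-cartesianProductWith (insert zero) (List.allFin (suc n)) (permutations n) _ ⟩
    ∑ᴸ (List.allFin (suc n)) (λ j → ∑ᴸ (permutations n) λ π →
      (- 1#) ^ inversions (insert zero j π) * (A zero j * diagonal j π))
      ≈⟨ ∑ᴸ-cong (List.allFin (suc n)) (λ j → begin
        ∑ᴸ (permutations n) (λ π →
          (- 1#) ^ inversions (insert zero j π) * (A zero j * diagonal j π))
          ≈⟨ ∑ᴸ-cong (permutations n) (λ π → trans
              (*-congʳ (trans (^-congʳ (- 1#) (inversions-insert j π))
                              (^-homo-* (- 1#) (toℕ j) (inversions π))))
              (interchange _ _ _ _)) ⟩
        ∑ᴸ (permutations n) (λ π →
          (sign j * A zero j) * ((- 1#) ^ inversions π * diagonal j π))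
          ≈⟨ ∑ᴸ-distribˡ (sign j * A zero j) (permutations n) _ ⟨
        (sign j * A zero j) * det R (minor A j)
          ≈⟨ *-assoc _ _ _ ⟩
        laplaceTerm A j ∎) ⟩
    ∑ᴸ (List.allFin (suc n)) (laplaceTerm A)
      ≈⟨ ∑ᴸ-tabulate {n = suc n} (λ j → j) (laplaceTerm A) ⟩
    sum (laplaceTerm A) ∎
    where
    diagonal : Fin (suc n) → Permutation′ n → Carrier
    diagonal j π = product (λ i → minor A j i (π ⟨$⟩ʳ i))

  det-empty : (A : Matrix 0) → det R A ≈ 1#
  det-empty A = trans (+-identityʳ _) (*-identityˡ 1#)

  det-cong : ∀ {n} {A B : Matrix n} → (∀ i j → A i j ≈ B i j) → det R A ≈ det R B
  det-cong {zero}          A≈B = refl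
  det-cong {suc n} {A} {B} A≈B = begin
    det R A              ≈⟨ det-expand A ⟩
    sum (laplaceTerm A)  ≈⟨ sum-cong-≋ {suc n} {laplaceTerm A} {laplaceTerm B} (λ j →
                              *-congˡ (*-cong (A≈B zero j) (det-cong λ i k → A≈B (suc i) (punchIn j k)))) ⟩
    sum (laplaceTerm B)  ≈⟨ det-expand B ⟨
    det R B              ∎

  -- Induction by Laplace expansion. In the term `j ≡ k` the entry splits and the three minors
  -- agree. In any other term column `k` survives in the minor at position `punchOut j≢k`, and the
  -- induction hypothesis applies there.
  det-linear : ∀ {n} {A B C : Matrix n} x (k : Fin n) →
               (∀ i → A i k ≈ B i k + x * C i k) →
               (∀ i j → j ≢ k → A i j ≈ B i j) → (∀ i j → j ≢ k → A i j ≈ C i j) →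
               det R A ≈ det R B + x * det R C
  det-linear {suc n} {A} {B} {C} x k A≈B+xC A≈B A≈C = begin
    det R A
      ≈⟨ det-expand A ⟩
    sum (laplaceTerm A)
      ≈⟨ sum-cong-≋ {suc n} {laplaceTerm A} {λ j → laplaceTerm B j + x * laplaceTerm C j} term ⟩
    sum (λ j → laplaceTerm B j + x * laplaceTerm C j)
      ≈⟨ ∑-distrib-+ {suc n} (laplaceTerm B) (λ j → x * laplaceTerm C j) ⟩
    sum (laplaceTerm B) + sum (λ j → x * laplaceTerm C j)
      ≈⟨ +-cong (det-expand B) (trans (*-congˡ (det-expand C)) (*-distribˡ-sum {suc n} x (laplaceTerm C))) ⟨
    det R B + x * det R C ∎
    where
    split : ∀ j → A zero j * det R (minor A j)
                  ≈ B zero j * det R (minor B j) + x * (C zero j * det R (minor C j))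
    split j with j Fin.≟ k
    ... | yes ≡.refl = begin
      A zero j * det R (minor A j)
        ≈⟨ *-congʳ (A≈B+xC zero) ⟩
      (B zero j + x * C zero j) * det R (minor A j)
        ≈⟨ distribʳ _ _ _ ⟩
      B zero j * det R (minor A j) + x * C zero j * det R (minor A j)
        ≈⟨ +-cong (*-congˡ (det-cong λ i m → A≈B (suc i) _ (Fin.punchInᵢ≢i j m)))
                  (trans (*-assoc _ _ _)
                    (*-congˡ (*-congˡ (det-cong λ i m → A≈C (suc i) _ (Fin.punchInᵢ≢i j m))))) ⟩
      B zero j * det R (minor B j) + x * (C zero j * det R (minor C j)) ∎
    ... | no j≢k = begin
      A zero j * det R (minor A j)
        ≈⟨ *-congˡ (det-linear x (punchOut j≢k)
             (λ i → ≡.subst (λ l → A (suc i) l ≈ B (suc i) l + x * C (suc i) l) (≡.sym k≡) (A≈B+xC (suc i)))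
             (λ i m m≢ → A≈B (suc i) _ (avoids m≢))
             (λ i m m≢ → A≈C (suc i) _ (avoids m≢))) ⟩
      A zero j * (det R (minor B j) + x * det R (minor C j))
        ≈⟨ distribˡ _ _ _ ⟩
      A zero j * det R (minor B j) + A zero j * (x * det R (minor C j))
        ≈⟨ +-cong (*-congʳ (A≈B zero j j≢k))
                  (trans (x∙yz≈y∙xz _ _ _) (*-congˡ (*-congʳ (A≈C zero j j≢k)))) ⟩
      B zero j * det R (minor B j) + x * (C zero j * det R (minor C j)) ∎
      where
      k≡ : punchIn j (punchOut j≢k) ≡ k
      k≡ = Fin.punchIn-punchOut j≢k
      avoids : ∀ {m} → m ≢ punchOut j≢k → punchIn j m ≢ k
      avoids m≢ e = m≢ (Fin.punchIn-injective j _ _ (≡.trans e (≡.sym k≡)))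
    term : ∀ j → laplaceTerm A j ≈ laplaceTerm B j + x * laplaceTerm C j
    term j = trans (*-congˡ (split j)) (trans (distribˡ _ _ _) (+-congˡ (x∙yz≈y∙xz _ _ _)))

  sum-zero : ∀ {n} {t : Fin n → Carrier} → (∀ j → t j ≈ 0#) → sum t ≈ 0#
  sum-zero {n} {t} t≈0 = trans (sum-cong-≋ {n} {t} {λ _ → 0#} t≈0) (sum-replicate-zero n)

  sum-adjacent : ∀ {n} (k : Fin n) (t : Fin (suc n) → Carrier) →
                 (∀ j → j ≢ inject₁ k → j ≢ suc k → t j ≈ 0#) →
                 sum t ≈ t (inject₁ k) + t (suc k)
  sum-adjacent zero    t t≈0 = +-congˡ
    (trans (+-congˡ (sum-zero λ j → t≈0 (suc (suc j)) (λ ()) (λ ()))) (+-identityʳ _))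
  sum-adjacent (suc k) t t≈0 = trans
    (+-cong (t≈0 zero (λ ()) (λ ()))
            (sum-adjacent k (t ∘ suc) λ j j≢k j≢k₊ →
               t≈0 (suc j) (j≢k ∘ Fin.suc-injective) (j≢k₊ ∘ Fin.suc-injective)))
    (+-identityˡ _)

  -- A Laplace term that deletes neither of the two columns has a minor with equal adjacent columns,
  -- so it vanishes by induction. The two remaining terms have equal entries and equal minors.
  det-equal-columns : ∀ {n} (A : Matrix (suc n)) (k : Fin n) →
                      (∀ i → A i (inject₁ k) ≈ A i (suc k)) → det R A ≈ 0#
  det-equal-columns {suc n} A k A≈ = begin
    det R A                         ≈⟨ det-expand A ⟩
    sum term                        ≈⟨ sum-adjacent k term vanishes ⟩
    -- The sign at `suc k` is `- 1#` times the sign at `inject₁ k`, so the two terms cancel.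
    term (inject₁ k) + term (suc k) ≈⟨ +-cong
      (*-cong (^-congʳ (- 1#) (Fin.toℕ-inject₁ k)) (*-cong (A≈ zero) (det-cong minors)))
      (trans (*-assoc (- 1#) _ _) (-1*x≈-x _)) ⟩
    _ + - _                         ≈⟨ -‿inverseʳ _ ⟩
    0#                              ∎
    where
    term : Fin (suc (suc n)) → Carrier
    term = laplaceTerm A
    vanishes : ∀ j → j ≢ inject₁ k → j ≢ suc k → term j ≈ 0#
    vanishes j j≢k j≢k₊ with l , e , e₊ ← punchIn-adjacent j k j≢k j≢k₊ = trans
      (*-congˡ (trans (*-congˡ (det-equal-columns (minor A j) l λ i →
        ≡.subst₂ (λ u v → A (suc i) u ≈ A (suc i) v) (≡.sym e) (≡.sym e₊) (A≈ (suc i))))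
        (zeroʳ _))) (zeroʳ _)
    minors : ∀ i m → minor A (inject₁ k) i m ≈ minor A (suc k) i m
    minors i m with punchIn-inject₁-suc k m
    ... | inj₁ e        = reflexive (≡.cong (A (suc i)) e)
    ... | inj₂ (e , e₊) =
      ≡.subst₂ (λ u v → A (suc i) u ≈ A (suc i) v) (≡.sym e) (≡.sym e₊) (sym (A≈ (suc i)))

  -- Linearity in column `inject₁ k` leaves an error term `x * det R C`, where `C` is `A` with that
  -- column overwritten by its right neighbour. Two adjacent columns of `C` are equal, so the error
  -- vanishes.
  det-add-column : ∀ {n} {A B : Matrix (suc n)} x (k : Fin n) →
                   (∀ i → A i (inject₁ k) ≈ B i (inject₁ k) + x * A i (suc k)) →
                   (∀ i j → j ≢ inject₁ k → A i j ≈ B i j) → det R A ≈ det R B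
  det-add-column {n} {A} {B} x k A≈B+xA A≈B = begin
    det R A               ≈⟨ det-linear x (inject₁ k) (λ i → trans (A≈B+xA i) (+-congˡ (*-congˡ (sym (at i)))))
                               A≈B (λ i j j≢ → sym (off i j j≢)) ⟩
    det R B + x * det R C ≈⟨ +-congˡ (trans (*-congˡ (det-equal-columns C k equal)) (zeroʳ x)) ⟩
    det R B + 0#          ≈⟨ +-identityʳ _ ⟩
    det R B               ∎
    where
    C : Matrix (suc n)
    C i j = if does (j Fin.≟ inject₁ k) then A i (suc k) else A i j
    at : ∀ i → C i (inject₁ k) ≈ A i (suc k)
    at i with inject₁ k Fin.≟ inject₁ k
    ... | yes _ = refl
    ... | no ¬e = ⊥-elim (¬e ≡.refl)
    off : ∀ i j → j ≢ inject₁ k → C i j ≈ A i j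
    off i j j≢ with j Fin.≟ inject₁ k
    ... | yes e = ⊥-elim (j≢ e)
    ... | no _  = refl
    equal : ∀ i → C i (inject₁ k) ≈ C i (suc k)
    equal i with suc k Fin.≟ inject₁ k
    -- `C i (suc k)` is `A i (suc k)` in both branches, so `at i` also covers this impossible
    -- equality.
    ... | yes e = at i
    ... | no _  = at i

  -- Induction by expansion along the first row. Deleting a column other than the last gives a minor
  -- of the same shape with the same corner, which factors out. Deleting the last column gives a
  -- minor whose last row is zero.
  det-last-row : ∀ {n} (A : Matrix (suc n)) → (∀ j → A (fromℕ n) (inject₁ j) ≈ 0#) →
                 det R A ≈ A (fromℕ n) (fromℕ n) * det R (λ i j → A (inject₁ i) (inject₁ j))
  det-last-row {zero}  A A≈0 = trans (det-expand A)
    (trans (+-identityʳ _) (*-identityˡ _))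
  det-last-row {suc n} A A≈0 = begin
    det R A                              ≈⟨ det-expand A ⟩
    sum term                             ≈⟨ sum-init-last term ⟩
    sum (λ j → term (inject₁ j)) + term (fromℕ (suc n))
                                         ≈⟨ +-cong (sum-cong-≋ {suc n} {λ j → term (inject₁ j)}
                                              {λ j → a * laplaceTerm B j} initial) final ⟩
    sum (λ j → a * laplaceTerm B j) + 0# ≈⟨ +-identityʳ _ ⟩
    sum (λ j → a * laplaceTerm B j)      ≈⟨ *-distribˡ-sum {suc n} a (laplaceTerm B) ⟨
    a * sum (laplaceTerm B)              ≈⟨ *-congˡ (det-expand B) ⟨
    a * det R B                          ∎
    where
    a = A (fromℕ (suc n)) (fromℕ (suc n))
    B : Matrix (suc n)
    B i j = A (inject₁ i) (inject₁ j)
    term : Fin (suc (suc n)) → Carrier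
    term = laplaceTerm A
    initial : ∀ j → term (inject₁ j) ≈ a * laplaceTerm B j
    initial j = begin
      sign (inject₁ j) * (B zero j * det R (minor A (inject₁ j)))
        ≈⟨ *-cong (^-congʳ (- 1#) (Fin.toℕ-inject₁ j)) (*-congˡ (trans
             (det-last-row (minor A (inject₁ j)) λ k →
                trans (reflexive (≡.cong (A _) (punchIn-inject₁ j k))) (A≈0 _))
             (*-cong (reflexive (≡.cong (A _) (punchIn-inject₁-fromℕ j)))
                     (det-cong λ i k → reflexive (≡.cong (A _) (punchIn-inject₁ j k)))))) ⟩
      sign j * (B zero j * (a * det R (minor B j)))
        ≈⟨ *-congˡ (x∙yz≈y∙xz _ _ _) ⟩
      sign j * (a * (B zero j * det R (minor B j)))
        ≈⟨ x∙yz≈y∙xz _ _ _ ⟩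
      a * laplaceTerm B j ∎
    row-zero : ∀ k → minor A (fromℕ (suc n)) (fromℕ n) k ≈ 0#
    row-zero k = trans (reflexive (≡.cong (A _) (punchIn-fromℕ k))) (A≈0 k)
    final : term (fromℕ (suc n)) ≈ 0#
    -- The induction hypothesis applies to this minor too, and its corner is zero as well.
    final = trans (*-congˡ (trans (*-congˡ (trans
      (det-last-row (minor A (fromℕ (suc n))) (λ k → row-zero (inject₁ k)))
      (trans (*-congʳ (row-zero (fromℕ n))) (zeroˡ _)))) (zeroʳ _))) (zeroʳ _)

-- The ring of formal power series over `R`.

module PowerSeries {c r} (R : CommutativeRing c r) where
  open CommutativeRing R hiding (zero)
  open import Algebra.Properties.CommutativeSemigroup +-commutativeSemigroup
    using (interchange; x∙yz≈y∙xz)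
  open import Relation.Binary.Reasoning.Setoid setoid

  Series : Set c
  Series = ℕ → Carrier

  infix 4 _≋_
  -- A record rather than a bare function type, so that unification recovers `f` and `g` from an
  -- equation between them.
  record _≋_ (f g : Series) : Set r where
    constructor coefficientwise
    field at : ∀ p → f p ≈ g p
  open _≋_ public

  constant : Carrier → Series
  constant x zero    = x
  constant x (suc p) = 0#

  0ˢ 1ˢ : Series
  0ˢ _ = 0#
  1ˢ = constant 1#

  t : Series
  t zero    = 0#
  t (suc p) = 1ˢ p

  infixl 6 _+ˢ_
  infixl 7 _⊛_

  _+ˢ_ : Series → Series → Series
  (f +ˢ g) p = f p + g p

  -ˢ_ : Series → Series
  (-ˢ f) p = - f p

  -- The Cauchy product. Writing `f` as `f zero` plus `t` times `f ∘ suc` turns it into a recursion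
  -- on the index of the coefficient.
  _⊛_ : Series → Series → Series
  (f ⊛ g) zero    = f zero * g zero
  (f ⊛ g) (suc p) = f zero * g (suc p) + ((f ∘ suc) ⊛ g) p

  ⊛-cong′ : ∀ {f f′ g g′} → (∀ p → f p ≈ f′ p) → (∀ p → g p ≈ g′ p) → ∀ p → (f ⊛ g) p ≈ (f′ ⊛ g′) p
  ⊛-cong′ f≈ g≈ zero    = *-cong (f≈ zero) (g≈ zero)
  ⊛-cong′ f≈ g≈ (suc p) = +-cong (*-cong (f≈ zero) (g≈ (suc p))) (⊛-cong′ (f≈ ∘ suc) g≈ p)

  ⊛-distribˡ : ∀ f g h p → (f ⊛ (g +ˢ h)) p ≈ (f ⊛ g) p + (f ⊛ h) p
  ⊛-distribˡ f g h zero    = distribˡ _ _ _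
  ⊛-distribˡ f g h (suc p) =
    trans (+-cong (distribˡ _ _ _) (⊛-distribˡ (f ∘ suc) g h p)) (interchange _ _ _ _)

  ⊛-distribʳ : ∀ f g h p → ((f +ˢ g) ⊛ h) p ≈ (f ⊛ h) p + (g ⊛ h) p
  ⊛-distribʳ f g h zero    = distribʳ _ _ _
  ⊛-distribʳ f g h (suc p) =
    trans (+-cong (distribʳ _ _ _) (⊛-distribʳ (f ∘ suc) (g ∘ suc) h p)) (interchange _ _ _ _)

  ⊛-scale : ∀ x f g p → ((λ q → x * f q) ⊛ g) p ≈ x * (f ⊛ g) p
  ⊛-scale x f g zero    = *-assoc _ _ _
  ⊛-scale x f g (suc p) =
    trans (+-cong (*-assoc _ _ _) (⊛-scale x (f ∘ suc) g p)) (sym (distribˡ _ _ _))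

  ⊛-zeroˡ : ∀ g p → (0ˢ ⊛ g) p ≈ 0#
  ⊛-zeroˡ g zero    = zeroˡ _
  ⊛-zeroˡ g (suc p) = trans (+-cong (zeroˡ _) (⊛-zeroˡ g p)) (+-identityˡ 0#)

  constant-⊛ : ∀ x g p → (constant x ⊛ g) p ≈ x * g p
  constant-⊛ x g zero    = refl
  constant-⊛ x g (suc p) = trans (+-congˡ (⊛-zeroˡ g p)) (+-identityʳ _)

  ⊛-identityˡ : ∀ g p → (1ˢ ⊛ g) p ≈ g p
  ⊛-identityˡ g p = trans (constant-⊛ 1# g p) (*-identityˡ _)

  -- The tail of `f ⊛ g` is a scalar multiple of the tail of `g` plus `(f ∘ suc) ⊛ g`.
  -- Distributivity separates the two; `⊛-scale` treats the first and induction the second.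
  ⊛-assoc : ∀ f g h p → ((f ⊛ g) ⊛ h) p ≈ (f ⊛ (g ⊛ h)) p
  ⊛-assoc f g h zero    = *-assoc _ _ _
  ⊛-assoc f g h (suc p) = begin
    f zero * g zero * h (suc p) + (((λ q → f zero * g (suc q)) +ˢ (f ∘ suc) ⊛ g) ⊛ h) p
      ≈⟨ +-cong (*-assoc _ _ _) (⊛-distribʳ (λ q → f zero * g (suc q)) _ h p) ⟩
    f zero * (g zero * h (suc p)) + (((λ q → f zero * g (suc q)) ⊛ h) p + (((f ∘ suc) ⊛ g) ⊛ h) p)
      ≈⟨ +-congˡ (+-cong (⊛-scale (f zero) (g ∘ suc) h p) (⊛-assoc (f ∘ suc) g h p)) ⟩
    f zero * (g zero * h (suc p)) + (f zero * ((g ∘ suc) ⊛ h) p + ((f ∘ suc) ⊛ (g ⊛ h)) p)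
      ≈⟨ +-assoc _ _ _ ⟨
    f zero * (g zero * h (suc p)) + f zero * ((g ∘ suc) ⊛ h) p + ((f ∘ suc) ⊛ (g ⊛ h)) p
      ≈⟨ +-congʳ (distribˡ _ _ _) ⟨
    f zero * (g ⊛ h) (suc p) + ((f ∘ suc) ⊛ (g ⊛ h)) p ∎

  -- The defining recursion mirrored to the second factor, from which commutativity follows by
  -- induction.
  ⊛-sucʳ : ∀ f g p → (f ⊛ g) (suc p) ≈ g zero * f (suc p) + (f ⊛ (g ∘ suc)) p
  ⊛-sucʳ f g zero    = trans (+-comm _ _) (+-congʳ (*-comm _ _))
  ⊛-sucʳ f g (suc p) = trans (+-congˡ (⊛-sucʳ (f ∘ suc) g p)) (x∙yz≈y∙xz _ _ _)

  ⊛-comm : ∀ f g p → (f ⊛ g) p ≈ (g ⊛ f) p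
  ⊛-comm f g zero    = *-comm _ _
  ⊛-comm f g (suc p) = trans (+-congˡ (⊛-comm (f ∘ suc) g p)) (sym (⊛-sucʳ g f p))

  seriesRing : CommutativeRing c r
  seriesRing = record
    { Carrier = Series ; _≈_ = _≋_ ; _+_ = _+ˢ_ ; _*_ = _⊛_ ; -_ = -ˢ_ ; 0# = 0ˢ ; 1# = 1ˢ
    ; isCommutativeRing = record
      { isRing = record
        { +-isAbelianGroup = record
          { isGroup = record
            { isMonoid = record
              { isSemigroup = record
                { isMagma = record
                  { isEquivalence = record
                    { refl  = coefficientwise λ _ → refl
                    ; sym   = λ e → coefficientwise λ p → sym (at e p)
                    ; trans = λ e e′ → coefficientwise λ p → trans (at e p) (at e′ p)
                    }
                  ; ∙-cong = λ e e′ → coefficientwise λ p → +-cong (at e p) (at e′ p)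
                  }
                ; assoc = λ _ _ _ → coefficientwise λ _ → +-assoc _ _ _
                }
              ; identity = (λ _ → coefficientwise λ _ → +-identityˡ _)
                         , (λ _ → coefficientwise λ _ → +-identityʳ _)
              }
            ; inverse = (λ _ → coefficientwise λ _ → -‿inverseˡ _)
                      , (λ _ → coefficientwise λ _ → -‿inverseʳ _)
            ; ⁻¹-cong = λ e → coefficientwise λ p → -‿cong (at e p)
            }
          ; comm = λ _ _ → coefficientwise λ _ → +-comm _ _
          }
        ; *-cong     = λ e e′ → coefficientwise (⊛-cong′ (at e) (at e′))
        ; *-assoc    = λ f g h → coefficientwise (⊛-assoc f g h)
        ; *-identity = (λ f → coefficientwise (⊛-identityˡ f))
                     , (λ f → coefficientwise λ p → trans (⊛-comm f 1ˢ p) (⊛-identityˡ f p))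
        ; distrib    = (λ f g h → coefficientwise (⊛-distribˡ f g h))
                     , (λ f g h → coefficientwise (⊛-distribʳ g h f))
        }
      ; *-comm = λ f g → coefficientwise (⊛-comm f g)
      }
    }

  t-⊛-zero : ∀ f → (t ⊛ f) zero ≈ 0#
  t-⊛-zero f = zeroˡ _

  t-⊛-suc : ∀ f p → (t ⊛ f) (suc p) ≈ f p
  t-⊛-suc f p = trans (+-cong (zeroˡ _) (⊛-identityˡ f p)) (+-identityˡ _)

-- Coefficients of determinants over the power series ring.

module SeriesDeterminant {c r} (R : CommutativeRing c r) where
  open CommutativeRing R hiding (zero)
  open PowerSeries R public
  open Determinant R public
  open import Algebra.Properties.Semiring.Sum semiring
  open import Algebra.Properties.Ring ring using (-0#≈0#)
  open import Relation.Binary.Reasoning.Setoid setoid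
  module 𝕊 = CommutativeRing seriesRing
  module 𝔻 = Determinant seriesRing
  open import Algebra.Properties.Semiring.Sum 𝕊.semiring using () renaming (sum to sumˢ)

  sumˢ-at : ∀ {n} (f : Fin n → Series) p → sumˢ f p ≈ sum (λ j → f j p)
  sumˢ-at {zero}  f p = refl
  sumˢ-at {suc n} f p = +-congˡ (sumˢ-at (f ∘ suc) p)

  -- The sign computed in the series ring is the constant series of the sign computed in `R`.
  sign-⊛ : ∀ {n} (j : Fin n) f p → (𝔻.sign j ⊛ f) p ≈ sign j * f p
  sign-⊛ zero    f p = constant-⊛ 1# f p
  sign-⊛ (suc j) f p = begin
    (((-ˢ 1ˢ) ⊛ 𝔻.sign j) ⊛ f) p ≈⟨ ⊛-assoc (-ˢ 1ˢ) (𝔻.sign j) f p ⟩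
    ((-ˢ 1ˢ) ⊛ (𝔻.sign j ⊛ f)) p ≈⟨ ⊛-cong′ -1ˢ≈ (sign-⊛ j f) p ⟩
    (constant (- 1#) ⊛ (λ q → sign j * f q)) p ≈⟨ constant-⊛ (- 1#) _ p ⟩
    - 1# * (sign j * f p) ≈⟨ *-assoc _ _ _ ⟨
    - 1# * sign j * f p ∎
    where
    -1ˢ≈ : ∀ q → (-ˢ 1ˢ) q ≈ constant (- 1#) q
    -1ˢ≈ zero    = refl
    -1ˢ≈ (suc q) = -0#≈0#

  det-expand-at : ∀ {n} (A : 𝔻.Matrix (suc n)) p →
    det seriesRing A p ≈ sum (λ j → sign j * (A zero j ⊛ det seriesRing (𝔻.minor A j)) p)
  det-expand-at {n} A p = begin
    det seriesRing A p           ≈⟨ at (𝔻.det-expand A) p ⟩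
    sumˢ (𝔻.laplaceTerm A) p     ≈⟨ sumˢ-at (𝔻.laplaceTerm A) p ⟩
    sum (λ j → 𝔻.laplaceTerm A j p)
      ≈⟨ sum-cong-≋ {suc n} {λ j → 𝔻.laplaceTerm A j p}
           (λ j → sign-⊛ j (A zero j ⊛ det seriesRing (𝔻.minor A j)) p) ⟩
    sum (λ j → sign j * (A zero j ⊛ det seriesRing (𝔻.minor A j)) p) ∎

  when : Bool → Carrier → Carrier
  when b x = if b then x else 0#

  *-when : ∀ b x y → x * when b y ≈ when b (x * y)
  *-when true  x y = refl
  *-when false x y = zeroʳ x

  -- Here `v` is the generating series of `F` by the weight `w`. Multiplying by `u` adds a choice of
  -- exponent `d` to the weight. Cutting `d` off at `c` loses nothing, since `d > p` rules out total
  -- weight `p`.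
  ⊛-weighted :
    ∀ {a} {X : Set a} (xs : List X) (w : X → ℕ) (F : X → Carrier) u v c {p} → p ≤ c →
    (∀ q → q ≤ p → v q ≈ ∑ᴸ xs (λ x → when (w x ≡ᵇ q) (F x))) →
    (u ⊛ v) p ≈ ∑ᴸ (List.upTo (suc c)) (λ d → ∑ᴸ xs (λ x → when (d ℕ.+ w x ≡ᵇ p) (u d * F x)))
  ⊛-weighted xs w F u v c p≤c v≈ = trans (go c u p≤c v≈) (sym (∑ᴸ-applyUpTo (λ d → d) (suc c) _))
    where
    ∑ᴸ-applyUpTo : ∀ {b} {B : Set b} (h : ℕ → B) n f →
                   ∑ᴸ (List.applyUpTo h n) f ≈ sum {n} (λ i → f (h (toℕ i)))
    ∑ᴸ-applyUpTo h zero    f = refl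
    ∑ᴸ-applyUpTo h (suc n) f = +-congˡ (∑ᴸ-applyUpTo (h ∘ suc) n f)
    scale : ∀ y p → v p ≈ ∑ᴸ xs (λ x → when (w x ≡ᵇ p) (F x)) →
            y * v p ≈ ∑ᴸ xs (λ x → when (w x ≡ᵇ p) (y * F x))
    scale y p v≈ = trans (*-congˡ v≈)
      (trans (∑ᴸ-distribˡ y xs _) (∑ᴸ-cong xs λ x → *-when (w x ≡ᵇ p) y (F x)))
    go : ∀ c u {p} → p ≤ c → (∀ q → q ≤ p → v q ≈ ∑ᴸ xs (λ x → when (w x ≡ᵇ q) (F x))) →
         (u ⊛ v) p ≈ sum {suc c} (λ d → ∑ᴸ xs (λ x → when (toℕ d ℕ.+ w x ≡ᵇ p) (u (toℕ d) * F x)))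
    -- Only `d = 0` contributes to the constant coefficient: for larger `d` the guard computes to
    -- `false`.
    go c u {zero} p≤c v≈ = sym (trans
      (+-cong (sym (scale (u 0) 0 (v≈ 0 z≤n)))
              (sum-zero {c} {λ d → ∑ᴸ xs (λ x → 0#)} (λ d → ∑ᴸ-zero xs)))
      (+-identityʳ _))
    go (suc c) u {suc p} (s≤s p≤c) v≈ = +-cong (scale (u 0) (suc p) (v≈ (suc p) ℕ.≤-refl))
      (go c (u ∘ suc) p≤c (λ q q≤p → v≈ q (ℕ.m≤n⇒m≤1+n q≤p)))

  coefficients : ∀ {m} → 𝔻.Matrix m → Vec ℕ m → Matrix m
  coefficients A δ i j = A i j (lookup δ i)

  -- By linearity in each row, the coefficient of `t^p` collects all ways to choose one exponent per
  -- row with total `p`. In the Laplace expansion row `zero` supplies `d` and the minor supplies the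
  -- rest. The bound `b` stays fixed because the product needs every coefficient of the minor up to
  -- `p`.
  det-at : ∀ {m} (A : 𝔻.Matrix m) b p → p ≤ b →
           det seriesRing A p ≈
           ∑ᴸ (boundedTuples m b) (λ δ → when (Vec.sum δ ≡ᵇ p) (det R (coefficients A δ)))
  det-at {zero} A b zero    _ = trans (at (𝔻.det-empty A) zero)
    (sym (trans (+-identityʳ _) (det-empty (coefficients A []))))
  det-at {zero} A b (suc p) _ = trans (at (𝔻.det-empty A) (suc p)) (sym (+-identityʳ _))
  det-at {suc m} A b p p≤b = begin
    det seriesRing A p
      ≈⟨ det-expand-at A p ⟩
    sum (λ j → sign j * (A zero j ⊛ det seriesRing (𝔻.minor A j)) p)
      ≈⟨ sum-cong-≋ {suc m} {λ j → sign j * (A zero j ⊛ det seriesRing (𝔻.minor A j)) p}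
           {λ j → ∑ᴸ ds λ d → ∑ᴸ δs λ δ → term d δ j} (λ j → begin
         sign j * (A zero j ⊛ det seriesRing (𝔻.minor A j)) p
           ≈⟨ *-congˡ (⊛-weighted δs Vec.sum (λ δ → det R (coefficients (𝔻.minor A j) δ))
                (A zero j) (det seriesRing (𝔻.minor A j)) b p≤b
                (λ q q≤p → det-at (𝔻.minor A j) b q (ℕ.≤-trans q≤p p≤b))) ⟩
         sign j * ∑ᴸ ds _
           ≈⟨ ∑ᴸ-distribˡ (sign j) ds _ ⟩
         ∑ᴸ ds (λ d → sign j * ∑ᴸ δs _)
           ≈⟨ ∑ᴸ-cong ds (λ d → ∑ᴸ-distribˡ (sign j) δs _) ⟩
         ∑ᴸ ds (λ d → ∑ᴸ δs (λ δ → term d δ j)) ∎) ⟩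
    -- The sum over columns moves inside, so that for each fixed `d ∷ δ` it becomes a Laplace
    -- expansion over `R`.
    sum (λ j → ∑ᴸ ds λ d → ∑ᴸ δs λ δ → term d δ j)
      ≈⟨ ∑ᴸ-sum-comm ds (λ d j → ∑ᴸ δs λ δ → term d δ j) ⟨
    ∑ᴸ ds (λ d → sum (λ j → ∑ᴸ δs λ δ → term d δ j))
      ≈⟨ ∑ᴸ-cong ds (λ d → ∑ᴸ-sum-comm δs (term d)) ⟨
    ∑ᴸ ds (λ d → ∑ᴸ δs λ δ → sum (term d δ))
      ≈⟨ ∑ᴸ-cong ds (λ d → ∑ᴸ-cong δs (collect d)) ⟩
    ∑ᴸ ds (λ d → ∑ᴸ δs λ δ → when (d ℕ.+ Vec.sum δ ≡ᵇ p) (det R (coefficients A (d ∷ δ))))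
      ≈⟨ ∑ᴸ-cartesianProductWith _∷_ ds δs _ ⟨
    ∑ᴸ (boundedTuples (suc m) b) (λ δ → when (Vec.sum δ ≡ᵇ p) (det R (coefficients A δ))) ∎
    where
    ds = List.upTo (suc b)
    δs = boundedTuples m b
    term : ℕ → Vec ℕ m → Fin (suc m) → Carrier
    term d δ j =
      sign j * when (d ℕ.+ Vec.sum δ ≡ᵇ p) (A zero j d * det R (coefficients (𝔻.minor A j) δ))
    collect : ∀ d δ →
      sum (term d δ) ≈ when (d ℕ.+ Vec.sum δ ≡ᵇ p) (det R (coefficients A (d ∷ δ)))
    collect d δ with d ℕ.+ Vec.sum δ ≡ᵇ p
    ... | true  = sym (det-expand (coefficients A (d ∷ δ)))
    ... | false = sum-zero {suc m} {λ j → sign j * 0#} (λ j → zeroʳ (sign j))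

  -- The embedding of constants respects sums and products, hence determinants; Laplace expansion
  -- makes this an induction.
  det-constant : ∀ {n} (A : Matrix n) p →
                 det seriesRing (λ i j → constant (A i j)) p ≈ constant (det R A) p
  det-constant {zero}  A zero    = trans (at (𝔻.det-empty λ i j → constant (A i j)) zero) (sym (det-empty A))
  det-constant {zero}  A (suc p) = at (𝔻.det-empty λ i j → constant (A i j)) (suc p)
  det-constant {suc n} A p = trans (det-expand-at (λ i j → constant (A i j)) p) (collect p)
    where
    term : ℕ → Fin (suc n) → Carrier
    term p j = sign j * (constant (A zero j) ⊛
                         det seriesRing (λ i k → constant (minor A j i k))) p
    step : ∀ p j → term p j ≈ sign j * (A zero j * constant (det R (minor A j)) p)
    step p j = *-congˡ (trans (constant-⊛ (A zero j) _ p) (*-congˡ (det-constant (minor A j) p)))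
    collect : ∀ p → sum (term p) ≈ constant (det R A) p
    collect zero    = trans (sum-cong-≋ {suc n} {term zero} {laplaceTerm A} (step zero))
                            (sym (det-expand A))
    collect (suc p) = sum-zero {suc n} {term (suc p)}
      (λ j → trans (step (suc p) j) (trans (*-congˡ (zeroʳ _)) (zeroʳ _)))

  -- Column reduction of the matrix of shifted series.

  module _ {ℓ} (h : Fin (suc ℓ) → ℕ → Carrier) where

    -- Columns j < k have already had t times the next column subtracted.
    reduced : ℕ → 𝔻.Matrix (suc ℓ)
    reduced k i j = if does (toℕ j ℕ.<? k) then constant (h i (toℕ j)) else λ d → h i (toℕ j ℕ.+ d)

    reduced-< : ∀ {k} i j → toℕ j < k → reduced k i j ≡ constant (h i (toℕ j))
    reduced-< {k} i j j<k = ≡.cong (if_then constant (h i (toℕ j)) else λ d → h i (toℕ j ℕ.+ d))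
      (dec-true (toℕ j ℕ.<? k) j<k)

    reduced-≥ : ∀ {k} i j → k ≤ toℕ j → reduced k i j ≡ λ d → h i (toℕ j ℕ.+ d)
    reduced-≥ {k} i j k≤j = ≡.cong (if_then constant (h i (toℕ j)) else λ d → h i (toℕ j ℕ.+ d))
      (dec-false (toℕ j ℕ.<? k) (ℕ.≤⇒≯ k≤j))

    -- Column `toℕ k` is its constant part plus `t` times the next column, which is still unreduced
    -- at this stage. Since `k : Fin ℓ`, a next column exists.
    det-reduced-suc : ∀ k → det seriesRing (reduced (toℕ k)) ≋ det seriesRing (reduced (suc (toℕ k)))
    det-reduced-suc k = 𝔻.det-add-column t k pivot others
      where
      k≡ = Fin.toℕ-inject₁ k
      pivot : ∀ i → reduced (toℕ k) i (inject₁ k) ≋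
                    reduced (suc (toℕ k)) i (inject₁ k) +ˢ t ⊛ reduced (toℕ k) i (suc k)
      pivot i rewrite reduced-≥ {toℕ k} i (inject₁ k) (ℕ.≤-reflexive (≡.sym k≡))
                    | reduced-< {suc (toℕ k)} i (inject₁ k) (s≤s (ℕ.≤-reflexive k≡))
                    | reduced-≥ {toℕ k} i (suc k) (ℕ.n≤1+n _)
                    | k≡ = coefficientwise λ
        -- The term with `t` contributes nothing to the constant coefficient. Beyond it,
        -- `toℕ k + suc p` and `suc (toℕ k) + p` are the same index.
        { zero    → trans (reflexive (≡.cong (h i) (ℕ.+-identityʳ _)))
                          (sym (trans (+-congˡ (t-⊛-zero (λ d → h i (suc (toℕ k) ℕ.+ d)))) (+-identityʳ _)))
        ; (suc p) → trans (reflexive (≡.cong (h i) (ℕ.+-suc _ p)))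
                          (sym (trans (+-congˡ (t-⊛-suc (λ d → h i (suc (toℕ k) ℕ.+ d)) p)) (+-identityˡ _)))
        }
      others : ∀ i j → j ≢ inject₁ k → reduced (toℕ k) i j ≋ reduced (suc (toℕ k)) i j
      others i j j≢k with toℕ j ℕ.<? toℕ k
      ... | yes j<k = 𝕊.reflexive (≡.trans (reduced-< i j j<k)
        (≡.sym (reduced-< i j (ℕ.m<n⇒m<1+n j<k))))
      ... | no j≮k  = 𝕊.reflexive (≡.trans (reduced-≥ i j (ℕ.≮⇒≥ j≮k)) (≡.sym (reduced-≥ i j
        (ℕ.≤∧≢⇒< (ℕ.≮⇒≥ j≮k) λ e → j≢k (Fin.toℕ-injective (≡.trans (≡.sym e) (≡.sym k≡)))))))

    det-reduced : ∀ k → k ≤ ℓ → det seriesRing (reduced 0) ≋ det seriesRing (reduced k)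
    det-reduced zero    _   = 𝕊.refl
    det-reduced (suc k) k<ℓ = 𝕊.trans (det-reduced k (ℕ.<⇒≤ k<ℓ))
      (≡.subst (λ k → det seriesRing (reduced k) ≋ det seriesRing (reduced (suc k)))
        (Fin.toℕ-fromℕ< k<ℓ) (det-reduced-suc (fromℕ< k<ℓ)))

    -- The `n`-th coefficient of one determinant, computed by `det-at` before the reduction and by
    -- `𝔻.det-last-row` after it. The hypothesis clears the last row of `reduced ℓ` up to its
    -- corner, the only series in that row left unreduced.
    ∑-det-shift : (∀ k → k < ℓ → h (fromℕ ℓ) k ≈ 0#) → ∀ n →
      ∑ᴸ (boundedTuples (suc ℓ) n)
         (λ δ → when (Vec.sum δ ≡ᵇ n) (det R λ i j → h i (toℕ j ℕ.+ lookup δ i)))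
      ≈ h (fromℕ ℓ) (ℓ ℕ.+ n) * det R (λ i j → h (inject₁ i) (toℕ j))
    ∑-det-shift h≈0 n = begin
      -- No column index lies below 0, so the entries of `reduced 0` compute to the full shifted
      -- series.
      _ ≈⟨ det-at (reduced 0) n n ℕ.≤-refl ⟨
      det seriesRing (reduced 0) n ≈⟨ at (det-reduced ℓ ℕ.≤-refl) n ⟩
      det seriesRing (reduced ℓ) n ≈⟨ at (𝔻.det-last-row (reduced ℓ) last-row) n ⟩
      (reduced ℓ (fromℕ ℓ) (fromℕ ℓ) ⊛ det seriesRing (λ i j → reduced ℓ (inject₁ i) (inject₁ j))) n
        ≈⟨ ⊛-cong′ corner (λ p → trans (at (𝔻.det-cong λ i j → 𝕊.reflexive (initial (inject₁ i) j)) p)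
                                       (det-constant (λ i j → h (inject₁ i) (toℕ j)) p)) n ⟩
      ((λ d → h (fromℕ ℓ) (ℓ ℕ.+ d)) ⊛ constant (det R λ i j → h (inject₁ i) (toℕ j))) n
        ≈⟨ ⊛-comm _ (constant _) n ⟩
      (constant (det R λ i j → h (inject₁ i) (toℕ j)) ⊛ (λ d → h (fromℕ ℓ) (ℓ ℕ.+ d))) n
        ≈⟨ trans (constant-⊛ _ _ n) (*-comm _ _) ⟩
      h (fromℕ ℓ) (ℓ ℕ.+ n) * det R (λ i j → h (inject₁ i) (toℕ j)) ∎
      where
      initial : ∀ i (j : Fin ℓ) → reduced ℓ i (inject₁ j) ≡ constant (h i (toℕ j))
      initial i j = ≡.trans
        (reduced-< i (inject₁ j) (≡.subst (_< ℓ) (≡.sym (Fin.toℕ-inject₁ j)) (Fin.toℕ<n j)))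
        (≡.cong (λ k → constant (h i k)) (Fin.toℕ-inject₁ j))
      last-row : ∀ j → reduced ℓ (fromℕ ℓ) (inject₁ j) ≋ 0ˢ
      last-row j = 𝕊.trans (𝕊.reflexive (initial (fromℕ ℓ) j))
        (coefficientwise λ { zero → h≈0 (toℕ j) (Fin.toℕ<n j) ; (suc p) → refl })
      corner : ∀ d → reduced ℓ (fromℕ ℓ) (fromℕ ℓ) d ≈ h (fromℕ ℓ) (ℓ ℕ.+ d)
      corner d = reflexive (≡.trans
        (≡.cong (λ f → f d) (reduced-≥ (fromℕ ℓ) (fromℕ ℓ) (ℕ.≤-reflexive (≡.sym (Fin.toℕ-fromℕ ℓ)))))
        (≡.cong (λ k → h (fromℕ ℓ) (k ℕ.+ d)) (Fin.toℕ-fromℕ ℓ)))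

-- Entries of vectors and integer index arithmetic.

lookup-last : ∀ {a} {A : Set a} {n} (xs : Vec A (suc n)) → lookup xs (fromℕ n) ≡ last xs
lookup-last {n = zero}  (x ∷ []) = ≡.refl
lookup-last {n = suc n} (x ∷ xs) = lookup-last xs

lookup-init : ∀ {a} {A : Set a} {n} (xs : Vec A (suc n)) (i : Fin n) →
              lookup xs (inject₁ i) ≡ lookup (init xs) i
lookup-init (x ∷ xs) zero    = ≡.refl
lookup-init (x ∷ xs) (suc i) = lookup-init xs i

lookup-⊕ : ∀ {m} (μ : Vec ℤ m) (δ : Vec ℕ m) i → lookup (μ ⊕ δ) i ≡ lookup μ i ℤ.+ + lookup δ i
lookup-⊕ μ δ i = ≡.trans (Vec.lookup-zipWith ℤ._+_ i μ (Vec.map +_ δ))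
  (≡.cong (ℤ._+_ (lookup μ i)) (Vec.lookup-map i +_ δ))

m<n⇒+m-+n<0 : ∀ {m n} → m < n → + m ℤ.- + n ℤ.< 0ℤ
m<n⇒+m-+n<0 {m} {n} m<n = ≡.subst (+ m ℤ.- + n ℤ.<_) (ℤ.+-inverseʳ (+ n))
  (ℤ.+-monoˡ-< (ℤ.- + n) (ℤ.+<+ m<n))

x+[m+n]-m≡x+n : ∀ x ℓ n → x ℤ.+ + (ℓ ℕ.+ n) ℤ.- + ℓ ≡ x ℤ.+ + n
x+[m+n]-m≡x+n x ℓ n = begin
  x ℤ.+ (+ ℓ ℤ.+ + n) ℤ.- + ℓ     ≡⟨ ≡.cong (λ y → x ℤ.+ y ℤ.- + ℓ) (ℤ.+-comm (+ ℓ) (+ n)) ⟩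
  x ℤ.+ (+ n ℤ.+ + ℓ) ℤ.- + ℓ     ≡⟨ ≡.cong (ℤ._- + ℓ) (ℤ.+-assoc x (+ n) (+ ℓ)) ⟨
  x ℤ.+ + n ℤ.+ + ℓ ℤ.- + ℓ       ≡⟨ ℤ.+-assoc (x ℤ.+ + n) (+ ℓ) (ℤ.- + ℓ) ⟩
  x ℤ.+ + n ℤ.+ (+ ℓ ℤ.- + ℓ)     ≡⟨ ≡.cong (ℤ._+_ (x ℤ.+ + n)) (ℤ.+-inverseʳ (+ ℓ)) ⟩
  x ℤ.+ + n ℤ.+ 0ℤ                ≡⟨ ℤ.+-identityʳ _ ⟩
  x ℤ.+ + n                       ∎
  where open ≡.≡-Reasoning


proposition3p7 : ∀ {c r} (R : CommutativeRing c r) →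
    let open CommutativeRing R in
    (ℓ : ℕ) (p q : ℤ) (g : ℤ → ℤ → Carrier) →
    (∀ k j → k ℤ.< 0ℤ → g k j ≈ 0#) →
    (μ : Vec ℤ (suc ℓ)) → last μ ≡ 0ℤ →
    (β : Vec ℤ ℓ) →
    let β′ = β ∷ʳ (q ℤ.- p) in
    g p q * s R g (init μ) β
    ≈ ∑ R (tuplesOfSize (suc ℓ) p) (λ δ → s R g (μ ⊕ δ) (β′ ⊕ δ))
-- For negative `p` the left side vanishes by the assumption on `g`. On the right the filter rejects
-- every tuple, since a natural number is never `-[1+ n ]`.
proposition3p7 R ℓ -[1+ n ] q g g≈0 μ μ≡0 β = begin
  g -[1+ n ] q * _ ≈⟨ *-congʳ (g≈0 -[1+ n ] q ℤ.-<+) ⟩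
  0# * _           ≈⟨ zeroˡ _ ⟩
  0#               ≈⟨ ∑ᴸ-zero (boundedTuples (suc ℓ) (suc n)) ⟨
  ∑ᴸ (boundedTuples (suc ℓ) (suc n)) (λ _ → 0#)
                   ≈⟨ ∑ᴸ-filter (λ δ → + Vec.sum δ ℤ.≟ -[1+ n ]) (boundedTuples (suc ℓ) (suc n)) _ ⟨
  ∑ R (tuplesOfSize (suc ℓ) -[1+ n ]) _ ∎
  where
  open CommutativeRing R
  open ListSum +-commutativeMonoid
  open import Relation.Binary.Reasoning.Setoid setoid
proposition3p7 R ℓ (+ n) q g g≈0 μ μ≡0 β = begin
  g (+ n) q * s R g (init μ) β
    ≈⟨ *-cong (reflexive (≡.sym corner)) (det-cong λ i j → reflexive (≡.sym (initial i j))) ⟩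
  h (fromℕ ℓ) (ℓ ℕ.+ n) * det R (λ i j → h (inject₁ i) (toℕ j))
    ≈⟨ ∑-det-shift h last-row n ⟨
  ∑ᴸ (boundedTuples (suc ℓ) n)
    (λ δ → when (Vec.sum δ ≡ᵇ n) (det R λ i j → h i (toℕ j ℕ.+ lookup δ i)))
    -- The decision `+ Vec.sum δ ℤ.≟ + n` computes to the guard `Vec.sum δ ≡ᵇ n`.
    ≈⟨ ∑ᴸ-filter (λ δ → + Vec.sum δ ℤ.≟ + n) (boundedTuples (suc ℓ) n) _ ⟨
  ∑ᴸ (tuplesOfSize (suc ℓ) (+ n)) (λ δ → det R λ i j → h i (toℕ j ℕ.+ lookup δ i))
    ≈⟨ ∑ᴸ-cong (tuplesOfSize (suc ℓ) (+ n)) (λ δ → det-cong λ i j → reflexive (shifted δ i j)) ⟩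
  ∑ R (tuplesOfSize (suc ℓ) (+ n)) (λ δ → s R g (μ ⊕ δ) (β′ ⊕ δ)) ∎
  where
  open CommutativeRing R hiding (zero)
  open SeriesDeterminant R
  open import Relation.Binary.Reasoning.Setoid setoid
  β′ = β ∷ʳ (q ℤ.- + n)

  -- Row `i` of the matrix for `μ` and `β′`, continued to all column indices. Adding `lookup δ i` to
  -- both parameters of the row amounts to moving that many columns to the right.
  h : Fin (suc ℓ) → ℕ → Carrier
  h i k = g (lookup μ i ℤ.+ + k ℤ.- + toℕ i) (lookup β′ i ℤ.+ + k ℤ.- + toℕ i)

  h-last : ∀ k → h (fromℕ ℓ) k ≡ g (0ℤ ℤ.+ + k ℤ.- + ℓ) (q ℤ.- + n ℤ.+ + k ℤ.- + ℓ)
  h-last k rewrite Fin.toℕ-fromℕ ℓ | lookup-last μ | μ≡0 | lookup-last β′ | Vec.last-∷ʳ (q ℤ.- + n) β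
    = ≡.refl

  -- As the last entry of `μ` is 0, the first index of `g` here is `k - ℓ`, which is negative.
  last-row : ∀ k → k ℕ.< ℓ → h (fromℕ ℓ) k ≈ 0#
  last-row k k<ℓ = trans (reflexive (h-last k)) (g≈0 _ _ (m<n⇒+m-+n<0 k<ℓ))

  -- The row offset `ℓ` cancels and leaves the indices `0 + n` and `(q - n) + n`; the last entry of
  -- `β′` is chosen so that the second one is `q`.
  corner : h (fromℕ ℓ) (ℓ ℕ.+ n) ≡ g (+ n) q
  corner = ≡.trans (h-last (ℓ ℕ.+ n)) (≡.cong₂ g (x+[m+n]-m≡x+n 0ℤ ℓ n)
    (≡.trans (x+[m+n]-m≡x+n (q ℤ.- + n) ℓ n) (≡.trans (ℤ.+-assoc q (ℤ.- + n) (+ n))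
      (≡.trans (≡.cong (ℤ._+_ q) (ℤ.+-inverseˡ (+ n))) (ℤ.+-identityʳ q)))))

  initial : ∀ i j → h (inject₁ i) (toℕ j) ≡
    g (lookup (init μ) i ℤ.+ + toℕ j ℤ.- + toℕ i) (lookup β i ℤ.+ + toℕ j ℤ.- + toℕ i)
  initial i j rewrite Fin.toℕ-inject₁ i | lookup-init μ i | lookup-init β′ i
                    | Vec.init-∷ʳ (q ℤ.- + n) β = ≡.refl

  shifted : ∀ δ i j → h i (toℕ j ℕ.+ lookup δ i) ≡
    g (lookup (μ ⊕ δ) i ℤ.+ + toℕ j ℤ.- + toℕ i) (lookup (β′ ⊕ δ) i ℤ.+ + toℕ j ℤ.- + toℕ i)
  shifted δ i j = ≡.cong₂ (λ x y → g (x ℤ.- + toℕ i) (y ℤ.- + toℕ i)) (move μ) (move β′)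
    where
    move : ∀ ν → lookup ν i ℤ.+ + (toℕ j ℕ.+ lookup δ i) ≡ lookup (ν ⊕ δ) i ℤ.+ + toℕ j
    move ν = ≡.trans (≡.cong (λ k → lookup ν i ℤ.+ + k) (ℕ.+-comm (toℕ j) (lookup δ i)))
      (≡.trans (≡.sym (ℤ.+-assoc (lookup ν i) (+ lookup δ i) (+ toℕ j)))
               (≡.cong (ℤ._+ + toℕ j) (≡.sym (lookup-⊕ ν δ i))))
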